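{- The FILA policy is a $3$-approximation algorithm for the linear tape sequencing problem (LTS): on every instance, the sequence $\pi$ it produces satisfies $\sum_{t=1}^n w_{\pi_t}R_t(\pi)\le 3R^*$. Moreover, FILA is optimal (its objective value equals $R^*$) if all tape files are of the same size.
   Context: LTS (linear tape sequencing problem). A tape is a set of files $\mathscr F=\{1,\dots,n\}$ stored contiguously, in index order from left to right, on a line. File $i$ has size $s_i$ (a positive integer number of bits), left position $\ell_i$ and right position $r_i=\ell_i+s_i$, with $\ell_1=0$, $\ell_{i+1}=r_i$, and tape length $L=r_n=\sum_i s_i$. Parameters $w_i\in\{0,1\}$ indicate whether file $i$ is requested ($w_i=1$) or not; it is assumed that $w_1=1$, and $m=\sum_i w_i$. The tape head starts at position $L$. A file is read by moving the head from $\ell_i$ to $r_i$; the head moves at unit speed. A solution is a permutation $\pi=(\pi_1,\dots,\pi_n)$ of $\mathscr F$ (reading order). The response time of the $t$-th file is $$R_t(\pi)=\sum_{t'=1}^{t}\bigl(s_{\pi_{t'-1}}+d_{\pi_{t'-1},\pi_{t'}}\bigr),\qquad d_{i,j}=|\ell_j-r_i|,$$ with the conventions $s_{\pi_0}=0$ and $r_{\pi_0}=L$. The objective value of $\pi$ is $\sum_{t=1}^n w_{\pi_t}R_t(\pi)$, and the LTS asks for $R^*=\min_\pi \sum_{t=1}^n w_{\pi_t}R_t(\pi)$. FILA (first-file-last) policy: reads the requested files in descending order of index, i.e. it outputs a permutation $\pi$ whose prefix $(\pi_1,\dots,\pi_m)$ consists of exactly the $m$ requested files, with $\pi_1>\pi_2>\dots>\pi_m=1$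 (the non-requested files follow in any order). -}

module Defs where

open import Data.Bool.Base using (Bool; true; false; if_then_else_)
open import Data.Fin.Base using (Fin; zero; suc; Fin′; toℕ; fromℕ; fromℕ<; inject; inject!; inject₁; punchIn)
import Data.Fin.Base as Fin
open import Data.Fin.Properties using (punchIn-punchOut; punchIn-mono-≤; toℕ-fromℕ<; toℕ-injective; _≟_)
open import Data.Fin.Permutation using (Permutation′; _⟨$⟩ʳ_; _⟨$⟩ˡ_; inverseʳ; _≈_; id; insert; remove; insert-remove; insert-punchIn)
open import Data.List.Base using (List; []; _∷_; map; allFin; cartesianProductWith)
open import Data.List.Extrema.Nat using (min; min≤v⁺; argmin-sel)
open import Data.List.Membership.Propositional using (_∈_)
open import Data.List.Membership.Propositional.Properties using (∈-allFin; ∈-cartesianProductWith⁺; ∈-map⁺; ∈-map⁻)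
open import Data.List.Relation.Unary.Any as Any using (here)
open import Data.Nat.Base using (ℕ; zero; suc; _+_; _*_; _≤_; _<_; z≤n; s≤s; s≤s⁻¹; s<s⁻¹; ∣_-_∣)
open import Data.Nat.Properties as ℕ using (+-0-commutativeMonoid)
open import Algebra.Properties.CommutativeMonoid.Sum +-0-commutativeMonoid using (sum; sum-cong-≗)
open import Data.Product.Base using (∃; _×_; _,_)
open import Data.Sum.Base using (inj₁; inj₂)
open import Data.Vec.Functional using (Vector)
open import Function.Base using (_∘_)
open import Function.Bundles using (_⇔_; mk⇔; Equivalence)
open import Relation.Binary.PropositionalEquality
open import Relation.Nullary using (yes; no; contradiction)

-- Files and reading steps are numbered from zero: file i + 1 is i : Fin n,
-- and π_{t+1} is π ⟨$⟩ʳ t.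

weight : Bool → ℕ
weight b = if b then 1 else 0

-- The number of files is suc n-1, because a first file must exist for w₁ = 1.
record LTS : Set where
  field
    n-1             : ℕ

  n : ℕ
  n = suc n-1

  field
    s               : Vector ℕ n
    s-positive      : ∀ i → 0 < s i
    requested       : Vector Bool n
    first-requested : requested zero ≡ true

  w : Vector ℕ n
  w i = weight (requested i)

  m : ℕ
  m = sum w

  L : ℕ
  L = sum s

  -- The total size of the files preceding i; see ℓ-suc.
  ℓ : Vector ℕ n
  ℓ i = sum {toℕ i} (λ (j : Fin′ i) → s (inject j))

  r : Vector ℕ n
  r i = ℓ i + s i

  d : Fin n → Fin n → ℕ
  d i j = ∣ ℓ j - r i ∣

  module _ (π : Permutation′ n) where

    -- s_{π_{t-1}} + d_{π_{t-1},π_t}, where the first step obeys the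
    -- conventions s_{π_0} = 0 and r_{π_0} = L.
    leg : Vector ℕ n
    leg zero    = 0 + ∣ ℓ (π ⟨$⟩ʳ zero) - L ∣
    leg (suc t) = s (π ⟨$⟩ʳ inject₁ t) + d (π ⟨$⟩ʳ inject₁ t) (π ⟨$⟩ʳ suc t)

    -- Fin′ (suc t) consists of the steps up to and including t.
    R : Vector ℕ n
    R t = sum (λ (t′ : Fin′ (suc t)) → leg (inject! t′))

    objective : ℕ
    objective = sum (λ t → w (π ⟨$⟩ʳ t) * R t)

    -- The order of the steps from m onwards is left unconstrained.
    record IsFILA : Set where
      field
        requested-prefix : ∀ t → (toℕ t < m) ⇔ (requested (π ⟨$⟩ʳ t) ≡ true)
        descending       : ∀ t u → t Fin.< u → toℕ u < m → π ⟨$⟩ʳ u Fin.< π ⟨$⟩ʳ t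
        first-file-last  : ∀ t → suc (toℕ t) ≡ m → π ⟨$⟩ʳ t ≡ zero

-- Every permutation of Fin n, up to pointwise equality; see
-- permutations-complete.
permutations : ∀ n → List (Permutation′ n)
permutations zero    = id ∷ []
permutations (suc n) = cartesianProductWith (insert zero) (allFin (suc n)) (permutations n)

-- min takes a default for the empty list as its first argument, which is
-- immaterial here: see R*-lower-bound and R*-attained.
R* : LTS → ℕ
R* I = min (objective id) (map objective (permutations n))
  where open LTS I

insert-cong : ∀ {n} (j : Fin (suc n)) {π ρ : Permutation′ n} →
              π ≈ ρ → insert zero j π ≈ insert zero j ρ
insert-cong j π≈ρ zero    = refl
insert-cong j π≈ρ (suc k) = cong (punchIn j) (π≈ρ k)

permutations-complete : ∀ {n} (π : Permutation′ n) → ∃ λ ρ → ρ ∈ permutations n × ρ ≈ π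
permutations-complete {zero}  π = id , here refl , λ ()
permutations-complete {suc n} π
  with ρ , ρ∈ , ρ≈ ← permutations-complete (remove zero π)
  = insert zero (π ⟨$⟩ʳ zero) ρ
  , ∈-cartesianProductWith⁺ (insert zero) (∈-allFin _) ρ∈
  , λ i → trans (insert-cong (π ⟨$⟩ʳ zero) {ρ} {remove zero π} ρ≈ i) (insert-remove zero π i)

module _ (I : LTS) where
  open LTS I

  leg-cong : ∀ π ρ → π ≈ ρ → leg π ≗ leg ρ
  leg-cong π ρ π≈ρ zero    = cong (λ i → ∣ ℓ i - L ∣) (π≈ρ zero)
  leg-cong π ρ π≈ρ (suc t) = cong₂ (λ i j → s i + d i j) (π≈ρ (inject₁ t)) (π≈ρ (suc t))

  objective-cong : ∀ π ρ → π ≈ ρ → objective π ≡ objective ρ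
  objective-cong π ρ π≈ρ = sum-cong-≗ λ t →
    cong₂ _*_ (cong w (π≈ρ t)) (sum-cong-≗ {suc (toℕ t)} λ t′ → leg-cong π ρ π≈ρ (inject! t′))

  R*-lower-bound : ∀ π → R* I ≤ objective π
  R*-lower-bound π with ρ , ρ∈ , ρ≈π ← permutations-complete π =
    min≤v⁺ _ _ (inj₂ (Any.map (λ e → ℕ.≤-reflexive (trans (sym e) (objective-cong ρ π ρ≈π)))
                              (∈-map⁺ objective ρ∈)))

  R*-attained : ∃ λ π → objective π ≡ R* I
  R*-attained with argmin-sel (λ x → x) (objective id) (map objective (permutations n))
  ... | inj₁ e = id , sym e
  ... | inj₂ R*∈ with π , _ , e ← ∈-map⁻ objective R*∈ = π , sym e

prefix-sum-suc : ∀ {n} (f : Vector ℕ (suc n)) (i : Fin n) →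
                 sum (λ (j : Fin′ (suc i)) → f (inject j)) ≡
                 sum (λ (j : Fin′ (inject₁ i)) → f (inject j)) + f (inject₁ i)
prefix-sum-suc f zero    = ℕ.+-identityʳ _
prefix-sum-suc f (suc i) =
  trans (cong (f zero +_) (prefix-sum-suc (f ∘ suc) i)) (sym (ℕ.+-assoc (f zero) _ _))

sum-as-prefix : ∀ {n} (f : Vector ℕ (suc n)) →
                sum (λ (j : Fin′ (fromℕ n)) → f (inject j)) + f (fromℕ n) ≡ sum f
sum-as-prefix {zero}  f = sym (ℕ.+-identityʳ _)
sum-as-prefix {suc n} f =
  trans (ℕ.+-assoc (f zero) _ _) (cong (f zero +_) (sum-as-prefix (f ∘ suc)))

module _ (I : LTS) where
  open LTS I

  ℓ-zero : ℓ zero ≡ 0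
  ℓ-zero = refl

  ℓ-suc : ∀ i → ℓ (suc i) ≡ r (inject₁ i)
  ℓ-suc = prefix-sum-suc s

  r-last : r (fromℕ n-1) ≡ L
  r-last = sum-as-prefix s

private
  Sorted : ∀ {n} → Vector Bool n → Permutation′ n → Set
  Sorted b π =
    (∀ t → (toℕ t < sum (weight ∘ b)) ⇔ (b (π ⟨$⟩ʳ t) ≡ true)) ×
    (∀ t u → t Fin.< u → toℕ u < sum (weight ∘ b) → π ⟨$⟩ʳ u Fin.< π ⟨$⟩ʳ t)

  count≤ : ∀ {n} (b : Vector Bool n) → sum (weight ∘ b) ≤ n
  count≤ {zero}  b = z≤n
  count≤ {suc n} b with b zero
  ... | true  = s≤s (count≤ (b ∘ suc))
  ... | false = ℕ.m≤n⇒m≤1+n (count≤ (b ∘ suc))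

  data View {n} (p : Fin (suc n)) : Fin (suc n) → Set where
    same  : View p p
    other : ∀ k → View p (punchIn p k)

  view : ∀ {n} (p t : Fin (suc n)) → View p t
  view p t with p ≟ t
  ... | yes refl = same
  ... | no p≢t   = subst (View p) (punchIn-punchOut p≢t) (other _)

  insert-same : ∀ {n} (p j : Fin (suc n)) (π : Permutation′ n) → insert p j π ⟨$⟩ʳ p ≡ j
  insert-same p j π with p ≟ p
  ... | yes _  = refl
  ... | no p≢p = contradiction refl p≢p

  punchIn-< : ∀ {n} c (p : Fin (suc n)) k →
              toℕ k < toℕ p → toℕ (punchIn p k) < weight c + toℕ p
  punchIn-< c (suc p) zero    _         rewrite ℕ.+-suc (weight c) (toℕ p) = s≤s z≤n
  punchIn-< c (suc p) (suc k) (s≤s k<p) rewrite ℕ.+-suc (weight c) (toℕ p) =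
    s≤s (punchIn-< c p k k<p)

  punchIn-<⁻ : ∀ {n} c (p : Fin (suc n)) k →
               toℕ (punchIn p k) < weight c + toℕ p → toℕ k < toℕ p
  punchIn-<⁻ true  zero    k       (s≤s ())
  punchIn-<⁻ false zero    k       ()
  punchIn-<⁻ c     (suc p) zero    _ = s≤s z≤n
  punchIn-<⁻ c     (suc p) (suc k) h rewrite ℕ.+-suc (weight c) (toℕ p) =
    s≤s (punchIn-<⁻ c p k (s<s⁻¹ h))

  sorted : ∀ {n} (b : Vector Bool n) → ∃ (Sorted b)
  sorted {zero}  b = id , (λ ()) , (λ ())
  sorted {suc n} b with π , prefix , desc ← sorted (b ∘ suc) = ρ , prefix′ , desc′
    where
    c = b zero
    m = sum (weight ∘ b ∘ suc)

    p : Fin (suc n)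
    p = fromℕ< (s≤s (count≤ (b ∘ suc)))

    p≡m : toℕ p ≡ m
    p≡m = toℕ-fromℕ< _

    ρ : Permutation′ (suc n)
    ρ = insert p zero π

    ρ-same : ρ ⟨$⟩ʳ p ≡ zero
    ρ-same = insert-same p zero π

    ρ-other : ∀ k → ρ ⟨$⟩ʳ punchIn p k ≡ suc (π ⟨$⟩ʳ k)
    ρ-other = insert-punchIn p zero π

    inner : ∀ k → toℕ (punchIn p k) < weight c + m → toℕ k < m
    inner k h = subst (toℕ k <_) p≡m
      (punchIn-<⁻ c p k (subst (λ x → toℕ (punchIn p k) < weight c + x) (sym p≡m) h))

    outer : ∀ c k → toℕ k < m → toℕ (punchIn p k) < weight c + m
    outer c k h = subst (λ x → toℕ (punchIn p k) < weight c + x) p≡m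
      (punchIn-< c p k (subst (toℕ k <_) (sym p≡m) h))

    at-p : ∀ c → (m < weight c + m) ⇔ (c ≡ true)
    at-p true  = mk⇔ (λ _ → refl) (λ _ → ℕ.≤-refl)
    at-p false = mk⇔ (λ m<m → contradiction m<m (ℕ.<-irrefl refl)) (λ ())

    prefix′ : ∀ t → (toℕ t < weight c + m) ⇔ (b (ρ ⟨$⟩ʳ t) ≡ true)
    prefix′ t with view p t
    ... | same    rewrite ρ-same | p≡m = at-p c
    ... | other k rewrite ρ-other k =
      mk⇔ (Equivalence.to (prefix k) ∘ inner k) (outer c k ∘ Equivalence.from (prefix k))

    desc′ : ∀ t u → t Fin.< u → toℕ u < weight c + m → ρ ⟨$⟩ʳ u Fin.< ρ ⟨$⟩ʳ t
    desc′ t u t<u u<m with view p t | view p u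
    ... | same    | same    = contradiction t<u (ℕ.<-irrefl refl)
    ... | same    | other k = contradiction (outer false k (inner k u<m))
                                (ℕ.<-asym (subst (_< toℕ (punchIn p k)) p≡m t<u))
    ... | other j | same    rewrite ρ-same | ρ-other j = s≤s z≤n
    ... | other j | other k rewrite ρ-other j | ρ-other k =
      s≤s (desc j k (ℕ.≰⇒> (λ k≤j → ℕ.<⇒≱ t<u (punchIn-mono-≤ p k j k≤j))) (inner k u<m))

FILA-exists : ∀ I → ∃ (LTS.IsFILA I)
FILA-exists I with π , prefix , desc ← sorted (LTS.requested I) = π , record
  { requested-prefix = prefix
  ; descending       = desc
  ; first-file-last  = last
  }
  where
  open LTS I

  last : ∀ t → suc (toℕ t) ≡ m → π ⟨$⟩ʳ t ≡ zero
  last t 1+t≡m with π ⟨$⟩ˡ zero ≟ t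
  ... | yes refl = inverseʳ π
  ... | no u≢t   = contradiction (subst (π ⟨$⟩ʳ t Fin.<_) (inverseʳ π) (desc _ t u<t (ℕ.≤-reflexive 1+t≡m))) λ ()
    where
    u<m : toℕ (π ⟨$⟩ˡ zero) < m
    u<m = Equivalence.from (prefix _) (trans (cong requested (inverseʳ π)) first-requested)

    u<t : π ⟨$⟩ˡ zero Fin.< t
    u<t = ℕ.≤∧≢⇒< (s≤s⁻¹ (subst (toℕ (π ⟨$⟩ˡ zero) <_) (sym 1+t≡m) u<m)) (u≢t ∘ toℕ-injective)

{-# OPTIONS --safe #-}

-- A head path from L to the left end of the t-th file makes net leftward
-- progress, so its length is the distance D from L to that end plus twice its
-- rightward movement, and the rightward movement is at least the total size of
-- the t - 1 files read before.  FILA moves right only while reading, hence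
-- attains this bound on every requested file.  Those earlier files all lie
-- between the current one and L, so FILA's response time is at most 3 D, while
-- any sequence needs at least D.  If all sizes equal c, the bound is
-- D + 2 (t - 1) c, and its weighted sum is least when the requested files come
-- first.
module Submission where

open import Defs
open import Data.Bool.Base using (Bool; true; false)
open import Data.Fin.Base using (Fin; Fin′; zero; suc; toℕ; inject; inject!; inject₁)
import Data.Fin.Base as Fin
open import Data.Fin.Induction using (<-weakInduction)
open import Data.Fin.Permutation using (Permutation′; _⟨$⟩ʳ_)
open import Data.Fin.Properties using (toℕ-inject₁)
open import Data.Nat.Base using (ℕ; zero; suc; _+_; _*_; _∸_; _≤_; _<_; z≤n; s≤s; s<s⁻¹; ∣_-_∣)
open import Data.Nat.Properties
open import Data.Nat.Solver using (module +-*-Solver)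
open import Data.Product.Base using (_×_; _,_)
open import Data.Vec.Functional using (Vector)
open import Function.Base using (_∘_)
open import Function.Bundles using (_⇔_; Equivalence)
open import Relation.Binary.PropositionalEquality
open import Relation.Nullary using (contradiction)

open import Algebra.Properties.CommutativeMonoid.Sum +-0-commutativeMonoid
  using (sum; sum-cong-≗; sum-permute; ∑-distrib-+)
open import Algebra.Properties.Semiring.Sum +-*-semiring using (*-distribˡ-sum; *-distribʳ-sum)
open +-*-Solver using (solve; _:+_; _:*_; _:=_; con)

-- Sums over initial segments

sum-mono-≤ : ∀ {n} {f g : Vector ℕ n} → (∀ i → f i ≤ g i) → sum f ≤ sum g
sum-mono-≤ {zero}  f≤g = z≤n
sum-mono-≤ {suc n} f≤g = +-mono-≤ (f≤g zero) (sum-mono-≤ (f≤g ∘ suc))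

-- Unfolds to `ℓ` when `f` is `s`, so the facts below apply directly to file positions; it also
-- serves for sizes taken in reading order.
prefixSum : ∀ {n} → Vector ℕ n → Vector ℕ n
prefixSum f i = sum (λ (j : Fin′ i) → f (inject j))

prefixSum-< : ∀ {n} (f : Vector ℕ n) {i j} → i Fin.< j → prefixSum f i + f i ≤ prefixSum f j
prefixSum-< f {zero}  {suc j} _   = m≤m+n (f zero) _
prefixSum-< f {suc i} {suc j} i<j = begin
  f zero + prefixSum (f ∘ suc) i + f (suc i)   ≡⟨ +-assoc (f zero) _ _ ⟩
  f zero + (prefixSum (f ∘ suc) i + f (suc i)) ≤⟨ +-monoʳ-≤ (f zero) (prefixSum-< (f ∘ suc) (s<s⁻¹ i<j)) ⟩
  f zero + prefixSum (f ∘ suc) j               ∎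
  where open ≤-Reasoning

prefixSum-≤-sum : ∀ {n} (f : Vector ℕ n) i → prefixSum f i + f i ≤ sum f
prefixSum-≤-sum f zero    = m≤m+n (f zero) _
prefixSum-≤-sum f (suc i) = begin
  f zero + prefixSum (f ∘ suc) i + f (suc i)   ≡⟨ +-assoc (f zero) _ _ ⟩
  f zero + (prefixSum (f ∘ suc) i + f (suc i)) ≤⟨ +-monoʳ-≤ (f zero) (prefixSum-≤-sum (f ∘ suc) i) ⟩
  f zero + sum (f ∘ suc)                       ∎
  where open ≤-Reasoning

prefixSum-const : ∀ {n} (f : Vector ℕ n) {c} → (∀ i → f i ≡ c) → ∀ i → prefixSum f i ≡ toℕ i * c
prefixSum-const f f≡c zero    = refl
prefixSum-const f f≡c (suc i) = cong₂ _+_ (f≡c zero) (prefixSum-const (f ∘ suc) (f≡c ∘ suc) i)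

-- Counterpart of `prefix-sum-suc` for `R`, whose sums include step `t` and are indexed through
-- `inject!`.
inclusivePrefixSum-suc : ∀ {n} (f : Vector ℕ (suc n)) (i : Fin n) →
                         sum (λ (j : Fin′ (suc (suc i))) → f (inject! j)) ≡
                         sum (λ (j : Fin′ (suc (inject₁ i))) → f (inject! j)) + f (suc i)
inclusivePrefixSum-suc f zero    = sym (trans (+-assoc (f zero) 0 _) (cong (f zero +_) (sym (+-identityʳ _))))
inclusivePrefixSum-suc f (suc i) =
  trans (cong (f zero +_) (inclusivePrefixSum-suc (f ∘ suc) i)) (sym (+-assoc (f zero) _ _))

-- Since p and q select equally many positions, each t may be charged t - m
-- instead, which is negative exactly on the positions selected by p; adding m
-- times the number of selected positions to the other side avoids subtraction.
initial-segment-minimal :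
  ∀ {n} (m : ℕ) (p q : Vector Bool n) → (∀ t → (toℕ t < m) ⇔ (p t ≡ true)) →
  sum (weight ∘ p) ≡ sum (weight ∘ q) →
  sum (λ t → weight (p t) * toℕ t) ≤ sum (λ t → weight (q t) * toℕ t)
initial-segment-minimal m p q initial Σp≡Σq = +-cancelʳ-≤ (sum (weight ∘ q) * m) _ _ (begin
  sum (at p) + sum (weight ∘ q) * m           ≡⟨ cong (sum (at p) +_) (*-distribʳ-sum m (weight ∘ q)) ⟩
  sum (at p) + sum (λ t → weight (q t) * m)   ≡⟨ ∑-distrib-+ (at p) _ ⟨
  sum (λ t → at p t + weight (q t) * m)       ≤⟨ sum-mono-≤ exchange ⟩
  sum (λ t → at q t + weight (p t) * m)       ≡⟨ ∑-distrib-+ (at q) _ ⟩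
  sum (at q) + sum (λ t → weight (p t) * m)   ≡⟨ cong (sum (at q) +_) (*-distribʳ-sum m (weight ∘ p)) ⟨
  sum (at q) + sum (weight ∘ p) * m           ≡⟨ cong (λ k → sum (at q) + k * m) Σp≡Σq ⟩
  sum (at q) + sum (weight ∘ q) * m           ∎)
  where
  open ≤-Reasoning

  at : Vector Bool _ → Vector ℕ _
  at b t = weight (b t) * toℕ t

  exchange : ∀ t → at p t + weight (q t) * m ≤ at q t + weight (p t) * m
  exchange t with p t in pt | q t
  ... | true  | true  = ≤-refl
  ... | false | false = ≤-refl
  ... | true  | false rewrite +-identityʳ (toℕ t + 0) =
    +-monoˡ-≤ 0 (<⇒≤ (Equivalence.from (initial t) pt))
  ... | false | true  rewrite +-identityʳ (toℕ t + 0) =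
    +-monoˡ-≤ 0 (≮⇒≥ λ t<m → contradiction (trans (sym pt) (Equivalence.to (initial t) t<m)) λ ())

-- Lower bound on the response times of any sequence

module _ (I : LTS) where
  open LTS I

  r≤L : ∀ i → r i ≤ L
  r≤L = prefixSum-≤-sum s

  ℓ≤L : ∀ i → ℓ i ≤ L
  ℓ≤L i = ≤-trans (m≤m+n (ℓ i) (s i)) (r≤L i)

  distance : Vector ℕ n
  distance i = L ∸ ℓ i

  -- The part of the lower bound that does not depend on the reading order.
  totalDistance : ℕ
  totalDistance = sum (λ i → w i * distance i)

  module _ (π : Permutation′ n) where

    readBefore : Vector ℕ n
    readBefore = prefixSum (λ t → s (π ⟨$⟩ʳ t))

    -- Length of a head path that moves right only while reading: every bit read before step `t` is
    -- crossed once rightwards and once more leftwards.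
    tightResponse : Vector ℕ n
    tightResponse t = distance (π ⟨$⟩ʳ t) + 2 * readBefore t

    R-zero : R π zero + ℓ (π ⟨$⟩ʳ zero) ≡ L
    R-zero = begin
      ∣ ℓ i - L ∣ + 0 + ℓ i ≡⟨ cong (_+ ℓ i) (+-identityʳ _) ⟩
      ∣ ℓ i - L ∣ + ℓ i     ≡⟨ cong (_+ ℓ i) (m≤n⇒∣m-n∣≡n∸m (ℓ≤L i)) ⟩
      L ∸ ℓ i + ℓ i         ≡⟨ m∸n+n≡m (ℓ≤L i) ⟩
      L                     ∎
      where
      open ≡-Reasoning
      i = π ⟨$⟩ʳ zero

    R-suc : ∀ t → R π (suc t) ≡ R π (inject₁ t) + leg π (suc t)
    R-suc = inclusivePrefixSum-suc (leg π)

    readBefore-suc : ∀ t → readBefore (suc t) ≡ readBefore (inject₁ t) + s (π ⟨$⟩ʳ inject₁ t)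
    readBefore-suc = prefix-sum-suc (λ t → s (π ⟨$⟩ʳ t))

    -- Adding `ℓ` clears the truncated subtraction in `distance`. The recursions below keep this
    -- form, and `ℓ` is cancelled where they are used.
    tightResponse+ℓ : ∀ t → tightResponse t + ℓ (π ⟨$⟩ʳ t) ≡ L + 2 * readBefore t
    tightResponse+ℓ t = begin
      distance i + p + ℓ i   ≡⟨ +-assoc (distance i) p (ℓ i) ⟩
      distance i + (p + ℓ i) ≡⟨ cong (distance i +_) (+-comm p (ℓ i)) ⟩
      distance i + (ℓ i + p) ≡⟨ +-assoc (distance i) (ℓ i) p ⟨
      distance i + ℓ i + p   ≡⟨ cong (_+ p) (m∸n+n≡m (ℓ≤L i)) ⟩
      L + p                  ∎
      where
      open ≡-Reasoning
      i = π ⟨$⟩ʳ t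
      p = 2 * readBefore t

    tightResponse-zero : tightResponse zero ≡ R π zero
    tightResponse-zero = +-cancelʳ-≡ (ℓ (π ⟨$⟩ʳ zero)) _ _
      (trans (tightResponse+ℓ zero) (trans (+-identityʳ L) (sym R-zero)))

    tightResponse-suc+ℓ : ∀ t → tightResponse (suc t) + ℓ (π ⟨$⟩ʳ suc t) ≡
                          tightResponse (inject₁ t) + s (π ⟨$⟩ʳ inject₁ t) + r (π ⟨$⟩ʳ inject₁ t)
    tightResponse-suc+ℓ t = begin
      tightResponse (suc t) + ℓ (π ⟨$⟩ʳ suc t) ≡⟨ tightResponse+ℓ (suc t) ⟩
      L + 2 * readBefore (suc t)               ≡⟨ cong (λ x → L + 2 * x) (readBefore-suc t) ⟩
      L + 2 * (b + s i)                        ≡⟨ solve 3 (λ L b s → L :+ con 2 :* (b :+ s) := L :+ con 2 :* b :+ (s :+ s)) refl L b (s i) ⟩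
      L + 2 * b + (s i + s i)                  ≡⟨ cong (_+ (s i + s i)) (tightResponse+ℓ (inject₁ t)) ⟨
      T + ℓ i + (s i + s i)                    ≡⟨ solve 3 (λ T ℓ s → T :+ ℓ :+ (s :+ s) := T :+ s :+ (ℓ :+ s)) refl T (ℓ i) (s i) ⟩
      T + s i + r i                            ∎
      where
      open ≡-Reasoning
      i = π ⟨$⟩ʳ inject₁ t
      b = readBefore (inject₁ t)
      T = tightResponse (inject₁ t)

    -- Shaped to match `tightResponse-suc+ℓ`: with `i` read just before `j`, the recursions differ
    -- only in having `d i j + ℓ j` here and `r i` there. These agree exactly when `ℓ j ≤ r i`.
    R-suc+ℓ : ∀ t → R π (suc t) + ℓ (π ⟨$⟩ʳ suc t) ≡
              R π (inject₁ t) + s (π ⟨$⟩ʳ inject₁ t) +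
              (d (π ⟨$⟩ʳ inject₁ t) (π ⟨$⟩ʳ suc t) + ℓ (π ⟨$⟩ʳ suc t))
    R-suc+ℓ t = trans (cong (_+ ℓ j) (R-suc t))
      (solve 4 (λ R s d ℓ → R :+ (s :+ d) :+ ℓ := R :+ s :+ (d :+ ℓ)) refl (R π (inject₁ t)) (s i) (d i j) (ℓ j))
      where
      i = π ⟨$⟩ʳ inject₁ t
      j = π ⟨$⟩ʳ suc t

    tightResponse≤R : ∀ t → tightResponse t ≤ R π t
    tightResponse≤R = <-weakInduction (λ t → tightResponse t ≤ R π t) (≤-reflexive tightResponse-zero) step
      where
      open ≤-Reasoning
      step : ∀ t → tightResponse (inject₁ t) ≤ R π (inject₁ t) → tightResponse (suc t) ≤ R π (suc t)
      step t ih = +-cancelʳ-≤ (ℓ j) _ _ (begin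
        tightResponse (suc t) + ℓ j               ≡⟨ tightResponse-suc+ℓ t ⟩
        tightResponse (inject₁ t) + s i + r i     ≤⟨ +-mono-≤ (+-monoˡ-≤ (s i) ih) r≤d+ℓ ⟩
        R π (inject₁ t) + s i + (d i j + ℓ j)     ≡⟨ R-suc+ℓ t ⟨
        R π (suc t) + ℓ j                         ∎)
        where
        i = π ⟨$⟩ʳ inject₁ t
        j = π ⟨$⟩ʳ suc t
        -- Triangle inequality on the line, the only loss in the bound.
        r≤d+ℓ : r i ≤ d i j + ℓ j
        r≤d+ℓ = subst (λ x → r i ≤ x + ℓ j) (∣-∣-comm (r i) (ℓ j)) (m≤∣m-n∣+n (r i) (ℓ j))

    -- Weighted sums of the bound

    weightedSum : Vector ℕ n → ℕ
    weightedSum f = sum (λ t → w (π ⟨$⟩ʳ t) * f t)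

    -- Other files have weight zero. This admits estimates for FILA that are known only on its first
    -- `m` steps.
    weightedSum-mono-≤ : ∀ (f g : Vector ℕ n) → (∀ t → requested (π ⟨$⟩ʳ t) ≡ true → f t ≤ g t) →
                         weightedSum f ≤ weightedSum g
    weightedSum-mono-≤ f g f≤g = sum-mono-≤ pointwise
      where
      pointwise : ∀ t → w (π ⟨$⟩ʳ t) * f t ≤ w (π ⟨$⟩ʳ t) * g t
      pointwise t with requested (π ⟨$⟩ʳ t) in req
      ... | true  = *-monoʳ-≤ 1 (f≤g t req)
      ... | false = z≤n

    sum-w : sum (λ t → w (π ⟨$⟩ʳ t)) ≡ m
    sum-w = sym (sum-permute w π)

    weightedSum-distance : weightedSum (λ t → distance (π ⟨$⟩ʳ t)) ≡ totalDistance
    weightedSum-distance = sym (sum-permute (λ i → w i * distance i) π)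

    weighted-tightResponse≤objective : weightedSum tightResponse ≤ objective π
    weighted-tightResponse≤objective = weightedSum-mono-≤ tightResponse (R π) (λ t _ → tightResponse≤R t)

    totalDistance≤objective : totalDistance ≤ objective π
    totalDistance≤objective = begin
      totalDistance
        ≡⟨ weightedSum-distance ⟨
      weightedSum (λ t → distance (π ⟨$⟩ʳ t))
        ≤⟨ weightedSum-mono-≤ (λ t → distance (π ⟨$⟩ʳ t)) tightResponse (λ t _ → m≤m+n (distance (π ⟨$⟩ʳ t)) _) ⟩
      weightedSum tightResponse
        ≤⟨ weighted-tightResponse≤objective ⟩
      objective π
        ∎
      where open ≤-Reasoning

    -- Here `readBefore t` is `toℕ t * c`, so the order matters only through the positions of the
    -- requested files.
    weighted-tightResponse-equalSizes :
      ∀ {c} → (∀ i → s i ≡ c) →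
      weightedSum tightResponse ≡ totalDistance + weightedSum toℕ * (2 * c)
    weighted-tightResponse-equalSizes {c} s≡c = begin
      weightedSum tightResponse
        ≡⟨ sum-cong-≗ pointwise ⟩
      sum (λ t → w (π ⟨$⟩ʳ t) * distance (π ⟨$⟩ʳ t) + w (π ⟨$⟩ʳ t) * toℕ t * (2 * c))
        ≡⟨ ∑-distrib-+ (λ t → w (π ⟨$⟩ʳ t) * distance (π ⟨$⟩ʳ t)) (λ t → w (π ⟨$⟩ʳ t) * toℕ t * (2 * c)) ⟩
      weightedSum (λ t → distance (π ⟨$⟩ʳ t)) + sum (λ t → w (π ⟨$⟩ʳ t) * toℕ t * (2 * c))
        ≡⟨ cong₂ _+_ weightedSum-distance (sym (*-distribʳ-sum (2 * c) (λ t → w (π ⟨$⟩ʳ t) * toℕ t))) ⟩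
      totalDistance + weightedSum toℕ * (2 * c)
        ∎
      where
      open ≡-Reasoning
      pointwise : ∀ t → w (π ⟨$⟩ʳ t) * tightResponse t ≡
                  w (π ⟨$⟩ʳ t) * distance (π ⟨$⟩ʳ t) + w (π ⟨$⟩ʳ t) * toℕ t * (2 * c)
      pointwise t rewrite prefixSum-const (λ u → s (π ⟨$⟩ʳ u)) (λ u → s≡c (π ⟨$⟩ʳ u)) t =
        solve 4 (λ w D t c → w :* (D :+ con 2 :* (t :* c)) := w :* D :+ w :* t :* (con 2 :* c))
          refl (w (π ⟨$⟩ʳ t)) (distance (π ⟨$⟩ʳ t)) (toℕ t) c

  -- FILA attains the bound on requested files

  module _ {π : Permutation′ n} (fila : IsFILA π) where
    open IsFILA fila

    r≤ℓ-next : ∀ t → toℕ (suc t) < m → r (π ⟨$⟩ʳ suc t) ≤ ℓ (π ⟨$⟩ʳ inject₁ t)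
    r≤ℓ-next t t<m = prefixSum-< s (descending (inject₁ t) (suc t) (s≤s (≤-reflexive (toℕ-inject₁ t))) t<m)

    inject₁-<m : ∀ (t : Fin n-1) → toℕ (suc t) < m → toℕ (inject₁ t) < m
    inject₁-<m t t<m = subst (_< m) (sym (toℕ-inject₁ t)) (<⇒≤ t<m)

    -- Each next file lies to the left of the previous one, so the triangle inequality
    -- `r i ≤ d i j + ℓ j` becomes an equality.
    FILA-R≡tightResponse : ∀ t → toℕ t < m → R π t ≡ tightResponse π t
    FILA-R≡tightResponse =
      <-weakInduction (λ t → toℕ t < m → R π t ≡ tightResponse π t) (λ _ → sym (tightResponse-zero π)) step
      where
      open ≡-Reasoning
      step : ∀ t → (toℕ (inject₁ t) < m → R π (inject₁ t) ≡ tightResponse π (inject₁ t)) →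
             toℕ (suc t) < m → R π (suc t) ≡ tightResponse π (suc t)
      step t ih t<m = +-cancelʳ-≡ (ℓ j) _ _ (begin
        R π (suc t) + ℓ j                           ≡⟨ R-suc+ℓ π t ⟩
        R π (inject₁ t) + s i + (d i j + ℓ j)       ≡⟨ cong₂ (λ x y → x + s i + y) (ih (inject₁-<m t t<m)) d+ℓ≡r ⟩
        tightResponse π (inject₁ t) + s i + r i     ≡⟨ tightResponse-suc+ℓ π t ⟨
        tightResponse π (suc t) + ℓ j               ∎)
        where
        i = π ⟨$⟩ʳ inject₁ t
        j = π ⟨$⟩ʳ suc t
        ℓj≤ri : ℓ j ≤ r i
        ℓj≤ri = ≤-trans (m≤m+n (ℓ j) (s j)) (≤-trans (r≤ℓ-next t t<m) (m≤m+n (ℓ i) (s i)))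
        d+ℓ≡r : d i j + ℓ j ≡ r i
        d+ℓ≡r = trans (cong (_+ ℓ j) (m≤n⇒∣m-n∣≡n∸m ℓj≤ri)) (m∸n+n≡m ℓj≤ri)

    -- The files already read are disjoint and lie between the current file and `L`. Using `r`
    -- instead of `ℓ` leaves room in the induction for the size of the file just read.
    FILA-readBefore+r≤L : ∀ t → toℕ t < m → readBefore π t + r (π ⟨$⟩ʳ t) ≤ L
    FILA-readBefore+r≤L =
      <-weakInduction (λ t → toℕ t < m → readBefore π t + r (π ⟨$⟩ʳ t) ≤ L) (λ _ → r≤L (π ⟨$⟩ʳ zero)) step
      where
      open ≤-Reasoning
      step : ∀ t → (toℕ (inject₁ t) < m → readBefore π (inject₁ t) + r (π ⟨$⟩ʳ inject₁ t) ≤ L) →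
             toℕ (suc t) < m → readBefore π (suc t) + r (π ⟨$⟩ʳ suc t) ≤ L
      step t ih t<m = begin
        readBefore π (suc t) + r j              ≡⟨ cong (_+ r j) (readBefore-suc π t) ⟩
        readBefore π (inject₁ t) + s i + r j    ≤⟨ +-monoʳ-≤ (readBefore π (inject₁ t) + s i) (r≤ℓ-next t t<m) ⟩
        readBefore π (inject₁ t) + s i + ℓ i    ≡⟨ +-assoc (readBefore π (inject₁ t)) (s i) (ℓ i) ⟩
        readBefore π (inject₁ t) + (s i + ℓ i)  ≡⟨ cong (readBefore π (inject₁ t) +_) (+-comm (s i) (ℓ i)) ⟩
        readBefore π (inject₁ t) + r i          ≤⟨ ih (inject₁-<m t t<m) ⟩
        L                                       ∎
        where
        i = π ⟨$⟩ʳ inject₁ t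
        j = π ⟨$⟩ʳ suc t

    FILA-R≤3*distance : ∀ t → toℕ t < m → R π t ≤ 3 * distance (π ⟨$⟩ʳ t)
    FILA-R≤3*distance t t<m = begin
      R π t                               ≡⟨ FILA-R≡tightResponse t t<m ⟩
      -- `3 * distance i` unfolds to `distance i + 2 * distance i`.
      distance i + 2 * readBefore π t     ≤⟨ +-monoʳ-≤ (distance i) (*-monoʳ-≤ 2 readBefore≤distance) ⟩
      3 * distance i                      ∎
      where
      open ≤-Reasoning
      i = π ⟨$⟩ʳ t
      readBefore≤distance : readBefore π t ≤ distance i
      readBefore≤distance = m+n≤o⇒m≤o∸n _
        (≤-trans (+-monoʳ-≤ (readBefore π t) (m≤m+n (ℓ i) (s i))) (FILA-readBefore+r≤L t t<m))

    requested⇒<m : ∀ t → requested (π ⟨$⟩ʳ t) ≡ true → toℕ t < m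
    requested⇒<m t = Equivalence.from (requested-prefix t)

    FILA-objective≤weighted-tightResponse : objective π ≤ weightedSum π (tightResponse π)
    FILA-objective≤weighted-tightResponse = weightedSum-mono-≤ π (R π) (tightResponse π)
      λ t req → ≤-reflexive (FILA-R≡tightResponse t (requested⇒<m t req))

    -- The order-independent `totalDistance` links the two sequences.
    FILA-3-approximation : ∀ ρ → objective π ≤ 3 * objective ρ
    FILA-3-approximation ρ = begin
      objective π
        ≤⟨ weightedSum-mono-≤ π (R π) (λ t → 3 * distance (π ⟨$⟩ʳ t))
             (λ t req → FILA-R≤3*distance t (requested⇒<m t req)) ⟩
      weightedSum π (λ t → 3 * distance (π ⟨$⟩ʳ t))
        ≡⟨ sum-cong-≗ (λ t → solve 2 (λ w D → w :* (con 3 :* D) := con 3 :* (w :* D))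
             refl (w (π ⟨$⟩ʳ t)) (distance (π ⟨$⟩ʳ t))) ⟩
      sum (λ t → 3 * (w (π ⟨$⟩ʳ t) * distance (π ⟨$⟩ʳ t)))
        ≡⟨ *-distribˡ-sum 3 (λ t → w (π ⟨$⟩ʳ t) * distance (π ⟨$⟩ʳ t)) ⟨
      3 * weightedSum π (λ t → distance (π ⟨$⟩ʳ t))
        ≡⟨ cong (3 *_) (weightedSum-distance π) ⟩
      3 * totalDistance
        ≤⟨ *-monoʳ-≤ 3 (totalDistance≤objective ρ) ⟩
      3 * objective ρ
        ∎
      where open ≤-Reasoning

    -- FILA meets its tight bound, and the bounds of `π` and `ρ` differ only in the position sums of
    -- the `m` requested files, which FILA minimizes by placing those files first.
    FILA-minimal-equalSizes : (∀ i j → s i ≡ s j) → ∀ ρ → objective π ≤ objective ρ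
    FILA-minimal-equalSizes s≡s ρ = begin
      objective π
        ≤⟨ FILA-objective≤weighted-tightResponse ⟩
      weightedSum π (tightResponse π)
        ≡⟨ weighted-tightResponse-equalSizes π s≡s₀ ⟩
      totalDistance + weightedSum π toℕ * (2 * s zero)
        ≤⟨ +-monoʳ-≤ totalDistance (*-monoˡ-≤ (2 * s zero) requested-first) ⟩
      totalDistance + weightedSum ρ toℕ * (2 * s zero)
        ≡⟨ weighted-tightResponse-equalSizes ρ s≡s₀ ⟨
      weightedSum ρ (tightResponse ρ)
        ≤⟨ weighted-tightResponse≤objective ρ ⟩
      objective ρ
        ∎
      where
      open ≤-Reasoning
      s≡s₀ : ∀ i → s i ≡ s zero
      s≡s₀ i = s≡s i zero
      requested-first : weightedSum π toℕ ≤ weightedSum ρ toℕ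
      requested-first = initial-segment-minimal m (λ t → requested (π ⟨$⟩ʳ t)) (λ t → requested (ρ ⟨$⟩ʳ t))
        requested-prefix (trans (sum-w π) (sym (sum-w ρ)))

-- Comparison with the optimum

proposition3 : (I : LTS) (π : Permutation′ (LTS.n I)) → LTS.IsFILA I π →
    (LTS.objective I π ≤ 3 * R* I) ×
    ((∀ i j → LTS.s I i ≡ LTS.s I j) → LTS.objective I π ≡ R* I)
-- Choosing `ρ` optimal turns the bounds against arbitrary sequences into bounds against `R*`.
proposition3 I π fila with ρ , ρ-optimal ← R*-attained I =
  subst (λ x → LTS.objective I π ≤ 3 * x) ρ-optimal (FILA-3-approximation I fila ρ) ,
  λ s≡s → ≤-antisym (subst (LTS.objective I π ≤_) ρ-optimal (FILA-minimal-equalSizes I fila s≡s ρ))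
                    (R*-lower-bound I π)
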